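{- Let $r\ge 1$ and let $m_1,\dots,m_r$ be integers with $m_i\ge 2$ for every $1\le i\le r$. Then for every integer $k\ge1$, $$ch_k(K_{m_1,\ldots,m_r})\le 948\, r\left(k+\log\frac{m_1+\cdots+m_r}{r}\right).$$
   Context: $K_{m_1,\ldots,m_r}$ denotes the complete $r$-partite graph with $m_i$ vertices in the $i$th vertex class. A graph $G=(V,E)$ is $(a:b)$-choosable if for every family of sets $\{S(v):v\in V\}$ with $|S(v)|=a$ for all $v$, there are subsets $C(v)\subseteq S(v)$ with $|C(v)|=b$ for all $v$ and $C(u)\cap C(v)=\emptyset$ for every two adjacent $u,v$. The $k$th choice number $ch_k(G)$ is the minimum $n$ such that $G$ is $(n:k)$-choosable. -}

module Defs where

open import Data.Nat using (ℕ; zero; suc; _+_; _*_; _^_; _≤_)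
open import Data.Nat using (_!)
open import Data.Fin using (Fin)
open import Data.Product using (Σ; _×_; _,_; ∃-syntax)
open import Data.Vec using (sum; tabulate)
open import Function.Definitions using (Injective)
open import Relation.Binary.PropositionalEquality using (_≡_; _≢_)

-- A graph given by a vertex type and an adjacency relation.
-- (a:b)-choosability: for every assignment of a-element colour sets S(v)
-- (colours are natural numbers; an a-set is given by an injective
-- enumeration Fin a → ℕ) there are b-element subsets C(v) ⊆ S(v)
-- (given by injective index maps Fin b → Fin a) such that C(u) ∩ C(v) = ∅
-- whenever u and v are adjacent.
Choosable : (V : Set) → (V → V → Set) → ℕ → ℕ → Set
Choosable V Adj a b =
  (S : V → Fin a → ℕ) → (∀ v → Injective _≡_ _≡_ (S v)) →
  Σ (V → Fin b → Fin a) λ C →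
    (∀ v → Injective _≡_ _≡_ (C v)) ×
    (∀ u v → Adj u v → ∀ i j → S u (C u i) ≢ S v (C v j))

KVertex : (r : ℕ) → (Fin r → ℕ) → Set
KVertex r m = Σ (Fin r) λ i → Fin (m i)

KAdj : (r : ℕ) (m : Fin r → ℕ) → KVertex r m → KVertex r m → Set
KAdj r m (i , _) (j , _) = i ≢ j

-- expNum t N = N! * Σ_{j=0}^{N} t^j / j!   (a natural number)
expNum : ℕ → ℕ → ℕ
expNum t zero = 1
expNum t (suc N) = suc N * expNum t N + t ^ suc N

-- ExpLe t p q  means  e^t ≤ p / q  (for q > 0), expressed exactly via the
-- partial sums of the exponential series (which increase to e^t):
--   ∀ N, Σ_{j≤N} t^j / j! ≤ p / q.
ExpLe : ℕ → ℕ → ℕ → Set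
ExpLe t p q = ∀ N → q * expNum t N ≤ p * (N !)

-- BoundOK r k M n  means  n ≤ 948 r (k + ln (M / r)), for n of the form
-- 948 r k + t:  t ≤ 948 r ln(M/r)  ⇔  e^t ≤ (M/r)^(948 r) = M^(948r) / r^(948r).
BoundOK : (r k M t : ℕ) → Set
BoundOK r k M t = ExpLe t (M ^ (948 * r)) (r ^ (948 * r))

-- ch_k(G) ≤ 948 r (k + ln((m_1+...+m_r)/r))  is rendered as: some number
-- n = 948 r k + t with n ≤ 948 r (k + ln(M/r)) has G (n:k)-choosable.

{-# OPTIONS --safe #-}
module Submission where

open import Defs
open import Data.Nat using (ℕ; _+_; _*_; _≤_)
open import Data.Fin using (Fin)
open import Data.Product using (_×_; ∃-syntax)
open import Data.Vec using (sum; tabulate)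
open import Data.Bool using (if_then_else_)
open import Data.Fin using (zero; suc; _≟_; combine; remQuot; inject≤; fromℕ<)
open import Data.Fin.Properties using (0≢1+n; suc-injective; all?; remQuot-combine; fromℕ<-injective; fromℕ<-cong)
open import Data.List using (List; []; _∷_; _++_; length; lookup; filter; foldr; concat)
open import Data.List.Membership.Propositional using (_∈_)
open import Data.List.Membership.Propositional.Properties using (∈-filter⁺; ∈-concat⁺′; ∈-tabulate⁺)
open import Data.List.Relation.Unary.Any using (here; there; index)
open import Data.List.Relation.Unary.Any.Properties using (lookup-index)
open import Data.Nat using (zero; suc; _∸_; _^_; _<_; _/_; _%_; _!; z≤n; s≤s; s≤s⁻¹; _≤?_; NonZero; >-nonZero)
open import Data.Nat.DivMod using (m/n*n≤m; m≡m%n+[m/n]*n; m%n<n)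
open import Data.Nat.Properties hiding (_≟_; 0≢1+n; suc-injective)
open import Data.Nat.Tactic.RingSolver using (solve-∀)
open import Data.Product using (Σ; _,_; proj₁; proj₂)
open import Data.Product.Properties using (≡-dec)
open import Data.Sum using (inj₁; inj₂)
open import Function using (_∘_)
open import Function.Definitions using (Injective)
open import Relation.Binary.Definitions using (DecidableEquality)
open import Relation.Binary.PropositionalEquality using (_≡_; _≢_; refl; sym; trans; cong; cong₂; module ≡-Reasoning)
open import Relation.Nullary using (¬_; Dec; yes; no; does; contradiction)
open import Relation.Nullary.Decidable using (_×-dec_; ¬?)
import Data.List as List
open import Algebra.Properties.Semiring.Sum +-*-semiring
  using (∑-comm; ∑-distrib-+; *-distribˡ-sum; *-distribʳ-sum; sum-cong-≗) renaming (sum to ∑)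
open import Algebra.Properties.CommutativeMonoid.Sum *-1-commutativeMonoid
  using () renaming (sum to ∏; ∑-comm to ∏-comm; ∑-distrib-+ to ∏-distrib-*; sum-cong-≗ to ∏-cong)

-- Colour the colours: each colour is assigned at random either to one of the
-- r classes, class i having weight k + l i where m i ≤ 2 ^ l i, or to a common
-- reserve, which has weight at least that of all the classes together. With
-- positive probability every list contains at least r * k reserve colours and
-- at most r vertices are bad, that is, see fewer than k colours of their own
-- class. Good vertices take k colours of their own class, and the at most r
-- bad vertices choose k reserve colours each, greedily. With M = Σ m i and
-- r * 2 ^ L ≤ M < r * 2 ^ (L + 1), the choice l i = L + ⌊m i / 2 ^ L⌋ keeps
-- Σ l i ≤ 3 r L, and lists of size 16 r (k + 3 L) suffice; e ≤ 4 turns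
-- L ≤ log₂ (M / r) into the bound on t = 474 r L.

-- Partial sums of the exponential series: e^t ≤ 4^t.

^-distribʳ-* : ∀ n x y → (x * y) ^ n ≡ x ^ n * y ^ n
^-distribʳ-* zero    x y = refl
^-distribʳ-* (suc n) x y rewrite ^-distribʳ-* n x y = lemma x y (x ^ n) (y ^ n)
  where
  lemma : ∀ x y p q → x * y * (p * q) ≡ x * p * (y * q)
  lemma = solve-∀

-- The mean value bound for x^(j+1) on [s, s+1], with the derivative taken at the right end. Applied
-- termwise, it controls the exponential series over one half step.
[1+s]^[1+j]≤s^[1+j]+[1+j]*[1+s]^j : ∀ s j → suc s ^ suc j ≤ s ^ suc j + suc j * suc s ^ j
[1+s]^[1+j]≤s^[1+j]+[1+j]*[1+s]^j s zero = ≤-reflexive (lemma s)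
  where
  lemma : ∀ s → suc s * 1 ≡ s * 1 + 1 * 1
  lemma = solve-∀
[1+s]^[1+j]≤s^[1+j]+[1+j]*[1+s]^j s (suc j) = begin
  suc s * suc s ^ suc j
    ≤⟨ +-monoʳ-≤ (suc s ^ suc j) (*-monoʳ-≤ s ([1+s]^[1+j]≤s^[1+j]+[1+j]*[1+s]^j s j)) ⟩
  suc s ^ suc j + s * (s ^ suc j + suc j * suc s ^ j)
    ≡⟨ cong (suc s ^ suc j +_) (*-distribˡ-+ s (s ^ suc j) _) ⟩
  suc s ^ suc j + (s ^ suc (suc j) + s * (suc j * suc s ^ j))
    ≤⟨ +-monoʳ-≤ (suc s ^ suc j) (+-monoʳ-≤ (s ^ suc (suc j)) (*-monoˡ-≤ (suc j * suc s ^ j) (n≤1+n s))) ⟩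
  suc s ^ suc j + (s ^ suc (suc j) + suc s * (suc j * suc s ^ j))
    ≡⟨ lemma (suc s) (suc s ^ j) (s ^ suc (suc j)) j ⟩
  s ^ suc (suc j) + suc (suc j) * suc s ^ suc j ∎
  where
  open ≤-Reasoning
  lemma : ∀ t x y j → t * x + (y + t * (suc j * x)) ≡ y + suc (suc j) * (t * x)
  lemma = solve-∀

-- halfExpNum s N = 2^N * N! * Σ_{j≤N} (s/2)^j / j!. With steps of 1/2 the mean value bound
-- e^(x+1/2) ≤ e^x + (1/2) e^(x+1/2) yields e^(x+1/2) ≤ 2 e^x, which steps of 1 would not.
halfExpNum : ℕ → ℕ → ℕ
halfExpNum s zero    = 1
halfExpNum s (suc N) = 2 * suc N * halfExpNum s N + s ^ suc N

halfExpNum-0 : ∀ N → halfExpNum 0 N ≡ 2 ^ N * N !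
halfExpNum-0 zero    = refl
halfExpNum-0 (suc N) rewrite halfExpNum-0 N = lemma (suc N) (2 ^ N) (N !)
  where
  lemma : ∀ n x y → 2 * n * (x * y) + 0 ≡ 2 * x * (n * y)
  lemma = solve-∀

halfExpNum-even : ∀ t N → halfExpNum (2 * t) N ≡ 2 ^ N * expNum t N
halfExpNum-even t zero    = refl
halfExpNum-even t (suc N)
  rewrite halfExpNum-even t N | ^-distribʳ-* (suc N) 2 t
  = lemma (suc N) (2 ^ N) (expNum t N) (t ^ suc N)
  where
  lemma : ∀ n x y z → 2 * n * (x * y) + 2 * x * z ≡ 2 * x * (n * y + z)
  lemma = solve-∀

-- The power bound added up over the terms. With E_N the N-th partial sum and x = s/2, this is
-- E_(N+1)(x + 1/2) ≤ E_(N+1)(x) + E_N(x + 1/2) / 2, cleared of denominators.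
halfExpNum-increment : ∀ s N →
  halfExpNum (suc s) (suc N) ≤ halfExpNum s (suc N) + suc N * halfExpNum (suc s) N
halfExpNum-increment s zero = ≤-reflexive (lemma s)
  where
  lemma : ∀ s → 2 * 1 * 1 + suc s * 1 ≡ 2 * 1 * 1 + s * 1 + 1 * 1
  lemma = solve-∀
halfExpNum-increment s (suc N) = begin
  2 * n * halfExpNum (suc s) (suc N) + suc s ^ n
    ≤⟨ +-mono-≤ (*-monoʳ-≤ (2 * n) (halfExpNum-increment s N))
                ([1+s]^[1+j]≤s^[1+j]+[1+j]*[1+s]^j s (suc N)) ⟩
  2 * n * (halfExpNum s (suc N) + suc N * halfExpNum (suc s) N) + (s ^ n + n * suc s ^ suc N)
    ≡⟨ lemma n (suc N) (halfExpNum s (suc N)) (halfExpNum (suc s) N) (s ^ n) (suc s ^ suc N) ⟩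
  halfExpNum s n + n * halfExpNum (suc s) (suc N) ∎
  where
  open ≤-Reasoning
  n = suc (suc N)
  lemma : ∀ n m p q y z → 2 * n * (p + m * q) + (y + n * z) ≡
          2 * n * p + y + n * (2 * m * q + z)
  lemma = solve-∀

halfExpNum-suc : ∀ s N → halfExpNum (suc s) N ≤ 2 * halfExpNum s N
halfExpNum-suc s zero    = s≤s z≤n
halfExpNum-suc s (suc N) = +-cancelʳ-≤ P _ _ (begin
  P + P                                             ≡⟨ cong (P +_) (+-identityʳ P) ⟨
  2 * P                                             ≤⟨ *-monoʳ-≤ 2 (halfExpNum-increment s N) ⟩
  2 * (Q + suc N * halfExpNum (suc s) N)            ≡⟨ *-distribˡ-+ 2 Q _ ⟩
  2 * Q + 2 * (suc N * halfExpNum (suc s) N)        ≡⟨ cong (2 * Q +_) (*-assoc 2 (suc N) _) ⟨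
  -- Adding the missing last term `suc s ^ suc N` completes `P`, and one copy of `P` then cancels
  -- from both sides.
  2 * Q + 2 * suc N * halfExpNum (suc s) N          ≤⟨ +-monoʳ-≤ (2 * Q) (m≤m+n _ _) ⟩
  2 * Q + P ∎)
  where
  open ≤-Reasoning
  P = halfExpNum (suc s) (suc N)
  Q = halfExpNum s (suc N)

halfExpNum≤2^s : ∀ s N → halfExpNum s N ≤ 2 ^ s * (2 ^ N * N !)
halfExpNum≤2^s zero    N = ≤-reflexive (trans (halfExpNum-0 N) (sym (*-identityˡ _)))
halfExpNum≤2^s (suc s) N = begin
  halfExpNum (suc s) N          ≤⟨ halfExpNum-suc s N ⟩
  2 * halfExpNum s N            ≤⟨ *-monoʳ-≤ 2 (halfExpNum≤2^s s N) ⟩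
  2 * (2 ^ s * (2 ^ N * N !))   ≡⟨ *-assoc 2 (2 ^ s) _ ⟨
  2 * 2 ^ s * (2 ^ N * N !)     ∎
  where open ≤-Reasoning

-- Reaching t from 0 takes `2 * t` half steps, each of which at most doubles the partial sum.
expNum≤4^t : ∀ t N → expNum t N ≤ 2 ^ (2 * t) * N !
expNum≤4^t t N = *-cancelˡ-≤ (2 ^ N) {{m^n≢0 2 N}} (begin
  2 ^ N * expNum t N                ≡⟨ halfExpNum-even t N ⟨
  halfExpNum (2 * t) N              ≤⟨ halfExpNum≤2^s (2 * t) N ⟩
  2 ^ (2 * t) * (2 ^ N * N !)       ≡⟨ lemma (2 ^ (2 * t)) (2 ^ N) (N !) ⟩
  2 ^ N * (2 ^ (2 * t) * N !)       ∎)
  where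
  open ≤-Reasoning
  lemma : ∀ x y z → x * (y * z) ≡ y * (x * z)
  lemma = solve-∀

-- 474 is half of 948 because e is replaced by 4 = 2 ^ 2: the power of 2 becomes exactly
-- `(2 ^ L) ^ (948 * r)`, and 2 ^ L ≤ M / r.
boundOK-dyadic : ∀ r k M L → r * 2 ^ L ≤ M → BoundOK r k M (474 * r * L)
boundOK-dyadic r k M L r2^L≤M N = begin
  r ^ e * expNum (474 * r * L) N       ≤⟨ *-monoʳ-≤ (r ^ e) (expNum≤4^t (474 * r * L) N) ⟩
  r ^ e * (2 ^ (2 * (474 * r * L)) * N !)  ≡⟨ cong (λ x → r ^ e * (2 ^ x * N !)) (exponent r L) ⟩
  r ^ e * (2 ^ (L * e) * N !)          ≡⟨ *-assoc (r ^ e) _ _ ⟨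
  r ^ e * 2 ^ (L * e) * N !            ≡⟨ cong (λ x → r ^ e * x * N !) (^-*-assoc 2 L e) ⟨
  r ^ e * (2 ^ L) ^ e * N !            ≡⟨ cong (_* N !) (^-distribʳ-* e r (2 ^ L)) ⟨
  (r * 2 ^ L) ^ e * N !                ≤⟨ *-monoˡ-≤ (N !) (^-monoˡ-≤ e r2^L≤M) ⟩
  M ^ e * N !                          ∎
  where
  open ≤-Reasoning
  e = 948 * r
  exponent : ∀ r L → 2 * (474 * r * L) ≡ L * (948 * r)
  exponent = solve-∀

-- Dyadic approximation of M / r.

n<2^n : ∀ n → n < 2 ^ n
n<2^n zero    = s≤s z≤n
n<2^n (suc n) = begin-strict
  suc n          ≡⟨ +-comm n 1 ⟨
  n + 1          <⟨ +-mono-<-≤ (n<2^n n) (m^n>0 2 n) ⟩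
  2 ^ n + 2 ^ n  ≡⟨ cong (2 ^ n +_) (+-identityʳ (2 ^ n)) ⟨
  2 ^ suc n      ∎
  where open ≤-Reasoning

-- A downward search from the exponent `suc M`, keeping the upper bound as its invariant. The
-- hypothesis `r * 2 ≤ M` stops it before L falls below 1; it will come from every class having at
-- least two vertices.
dyadic-bracket : ∀ r M → 1 ≤ r → r * 2 ≤ M →
                 ∃[ L ] (1 ≤ L × r * 2 ^ L ≤ M × M < r * 2 ^ suc L)
dyadic-bracket r M 1≤r 2r≤M = search M (begin-strict
    M                <⟨ n<2^n M ⟩
    2 ^ M            ≤⟨ ^-monoʳ-≤ 2 (n≤1+n M) ⟩
    2 ^ suc M        ≡⟨ *-identityˡ _ ⟨
    1 * 2 ^ suc M    ≤⟨ *-monoˡ-≤ (2 ^ suc M) 1≤r ⟩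
    r * 2 ^ suc M    ∎)
  where
  open ≤-Reasoning
  search : ∀ d → M < r * 2 ^ suc d → ∃[ L ] (1 ≤ L × r * 2 ^ L ≤ M × M < r * 2 ^ suc L)
  search zero    M<  = contradiction 2r≤M (<⇒≱ M<)
  search (suc d) M< with r * 2 ^ suc d ≤? M
  ... | yes ≤M = suc d , s≤s z≤n , ≤M , M<
  ... | no ≰M  = search d (≰⇒> ≰M)

-- Exponential decay of (1 - w/(y+w))^n in integers.

bernoulli : ∀ y j → y ^ suc j + suc j * y ^ j ≤ suc y ^ suc j
bernoulli y zero    = ≤-reflexive (lemma y)
  where
  lemma : ∀ y → y * 1 + 1 * 1 ≡ suc y * 1
  lemma = solve-∀
bernoulli y (suc j) = begin
  y * (y * y ^ j) + suc (suc j) * (y * y ^ j)          ≡⟨ lemma y (y ^ j) j ⟩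
  y * y ^ j + y * (y * y ^ j + suc j * y ^ j)          ≤⟨ +-monoˡ-≤ (y * (y * y ^ j + suc j * y ^ j)) (m≤m+n (y * y ^ j) (suc j * y ^ j)) ⟩
  suc y * (y * y ^ j + suc j * y ^ j)                  ≤⟨ *-monoʳ-≤ (suc y) (bernoulli y j) ⟩
  suc y * suc y ^ suc j                                ∎
  where
  open ≤-Reasoning
  lemma : ∀ y p j → y * (y * p) + suc (suc j) * (y * p) ≡ y * p + y * (y * p + suc j * p)
  lemma = solve-∀

-- Bernoulli with j = y, where the linear term is at least a second copy of `y ^ suc y`. As a
-- quotient: (1 - 1/(y+1))^(y+1) ≤ 1/2.
2*y^[1+y]≤[1+y]^[1+y] : ∀ y → 2 * y ^ suc y ≤ suc y ^ suc y
2*y^[1+y]≤[1+y]^[1+y] y = begin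
  2 * y ^ suc y              ≡⟨ cong (y ^ suc y +_) (+-identityʳ (y ^ suc y)) ⟩
  y ^ suc y + y * y ^ y      ≤⟨ +-monoʳ-≤ (y ^ suc y) (*-monoˡ-≤ (y ^ y) (n≤1+n y)) ⟩
  y ^ suc y + suc y * y ^ y  ≤⟨ bernoulli y y ⟩
  suc y ^ suc y              ∎
  where open ≤-Reasoning

-- The exponent `n` holds `c` blocks of length `suc y`, and each block gains a factor 2. The
-- remaining `d` factors only use y ≤ y + 1.
2^c*y^n≤[1+y]^n : ∀ c y n → c * suc y ≤ n → 2 ^ c * y ^ n ≤ suc y ^ n
2^c*y^n≤[1+y]^n c y n cu≤n = begin
  2 ^ c * y ^ n                 ≡⟨ cong (2 ^ c *_) (split y) ⟩
  2 ^ c * ((y ^ u) ^ c * y ^ d) ≡⟨ *-assoc (2 ^ c) _ _ ⟨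
  2 ^ c * (y ^ u) ^ c * y ^ d   ≡⟨ cong (_* y ^ d) (^-distribʳ-* c 2 (y ^ u)) ⟨
  (2 * y ^ u) ^ c * y ^ d       ≤⟨ *-mono-≤ (^-monoˡ-≤ c (2*y^[1+y]≤[1+y]^[1+y] y)) (^-monoˡ-≤ d (n≤1+n y)) ⟩
  (u ^ u) ^ c * u ^ d           ≡⟨ split u ⟨
  u ^ n                         ∎
  where
  open ≤-Reasoning
  u = suc y
  d = n ∸ c * u
  split : ∀ z → z ^ n ≡ (z ^ u) ^ c * z ^ d
  split z = begin-equality
    z ^ n                ≡⟨ cong (z ^_) (m+[n∸m]≡n cu≤n) ⟨
    z ^ (c * u + d)      ≡⟨ ^-distribˡ-+-* z (c * u) d ⟩
    z ^ (c * u) * z ^ d  ≡⟨ cong (λ e → z ^ e * z ^ d) (*-comm c u) ⟩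
    z ^ (u * c) * z ^ d  ≡⟨ cong (_* z ^ d) (^-*-assoc z u c) ⟨
    (z ^ u) ^ c * z ^ d  ∎

-- An integer form of (1 - w/(y+w))^n ≤ 2^(-cw).
2^[c*w]*y^n≤[y+w]^n : ∀ c w y n → c * (y + w) ≤ n → 2 ^ (c * w) * y ^ n ≤ (y + w) ^ n
2^[c*w]*y^n≤[y+w]^n c zero y n _ rewrite *-zeroʳ c | +-identityʳ y = ≤-reflexive (+-identityʳ _)
2^[c*w]*y^n≤[y+w]^n c (suc w) y n cu≤n = begin
  2 ^ (c * suc w) * y ^ n             ≡⟨ cong (λ e → 2 ^ e * y ^ n) (*-suc c w) ⟩
  2 ^ (c + c * w) * y ^ n             ≡⟨ cong (_* y ^ n) (^-distribˡ-+-* 2 c (c * w)) ⟩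
  2 ^ c * 2 ^ (c * w) * y ^ n         ≡⟨ *-assoc (2 ^ c) _ _ ⟩
  -- The base climbs from y to y + w in unit steps, each worth a factor `2 ^ c`. All the bases stay
  -- at most y + w, so the one hypothesis on `n` serves every step.
  2 ^ c * (2 ^ (c * w) * y ^ n)       ≤⟨ *-monoʳ-≤ (2 ^ c) (2^[c*w]*y^n≤[y+w]^n c w y n
                                           (≤-trans (*-monoʳ-≤ c (+-monoʳ-≤ y (n≤1+n w))) cu≤n)) ⟩
  2 ^ c * (y + w) ^ n                 ≤⟨ 2^c*y^n≤[1+y]^n c (y + w) n
                                           (≤-trans (≤-reflexive (cong (c *_) (sym (+-suc y w)))) cu≤n) ⟩
  suc (y + w) ^ n                     ≡⟨ cong (_^ n) (+-suc y w) ⟨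
  (y + suc w) ^ n                     ∎
  where open ≤-Reasoning

-- Finite sums, products and counting.

∑-mono : ∀ {n} {f g : Fin n → ℕ} → (∀ i → f i ≤ g i) → ∑ f ≤ ∑ g
∑-mono {zero}  f≤g = z≤n
∑-mono {suc n} f≤g = +-mono-≤ (f≤g zero) (∑-mono (f≤g ∘ suc))

∑-const : ∀ n c → ∑ {n} (λ _ → c) ≡ n * c
∑-const zero    c = refl
∑-const (suc n) c = cong (c +_) (∑-const n c)

term≤∑ : ∀ {n} (f : Fin n → ℕ) i → f i ≤ ∑ f
term≤∑ f zero    = m≤m+n _ _
term≤∑ f (suc i) = ≤-trans (term≤∑ (f ∘ suc) i) (m≤n+m _ (f zero))

∏-const : ∀ n c → ∏ {n} (λ _ → c) ≡ c ^ n
∏-const zero    c = refl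
∏-const (suc n) c = cong (c *_) (∏-const n c)

∏-^-∑ : ∀ {n} x (e : Fin n → ℕ) → ∏ (λ j → x ^ e j) ≡ x ^ ∑ e
∏-^-∑ {zero}  x e = refl
∏-^-∑ {suc n} x e = trans (cong (x ^ e zero *_) (∏-^-∑ x (e ∘ suc))) (sym (^-distribˡ-+-* x (e zero) _))

-- Summing over positions makes the library lemmas about ∑ apply to lists.
∑[_] : {I : Set} → List I → (I → ℕ) → ℕ
∑[ xs ] g = ∑ (λ i → g (lookup xs i))

term≤∑[] : {I : Set} {xs : List I} (g : I → ℕ) {x : I} → x ∈ xs → g x ≤ ∑[ xs ] g
term≤∑[] g (here refl) = m≤m+n _ _
term≤∑[] {xs = y ∷ _} g (there x∈xs) = ≤-trans (term≤∑[] g x∈xs) (m≤n+m _ (g y))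

𝟙 : {P : Set} → Dec P → ℕ
𝟙 d = if does d then 1 else 0

𝟙-yes : {P : Set} (d : Dec P) → P → 𝟙 d ≡ 1
𝟙-yes (yes _) p = refl
𝟙-yes (no ¬p) p = contradiction p ¬p

𝟙-no : {P : Set} (d : Dec P) → ¬ P → 𝟙 d ≡ 0
𝟙-no (yes p) ¬p = contradiction p ¬p
𝟙-no (no _)  ¬p = refl

count : ∀ {n} {P : Fin n → Set} → (∀ j → Dec (P j)) → ℕ
count P? = ∑ (λ j → 𝟙 (P? j))

select : ∀ {n} {P : Fin n → Set} (P? : ∀ j → Dec (P j)) k → k ≤ count P? →
         Σ (Fin k → Fin n) λ C → Injective _≡_ _≡_ C × (∀ i → P (C i))
select P? zero _ = (λ ()) , (λ { {()} }) , (λ ())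
select {suc n} P? (suc k) k≤ with P? zero
... | no _  = let C , inj , PC = select (P? ∘ suc) (suc k) k≤ in
              suc ∘ C , inj ∘ suc-injective , PC
... | yes p = let C , inj , PC = select (P? ∘ suc) k (s≤s⁻¹ k≤) in
              (λ { zero → zero ; (suc i) → suc (C i) }) ,
              (λ { {zero} {zero} _ → refl
                 ; {zero} {suc _} ()
                 ; {suc _} {zero} ()
                 ; {suc _} {suc _} eq → cong suc (inj (suc-injective eq)) }) ,
              (λ { zero → p ; (suc i) → PC i })

module _ {X : Set} (_≟X_ : DecidableEquality X) where

  count-fibre≤1 : ∀ {n} (S : Fin n → X) → Injective _≡_ _≡_ S → ∀ c → count (λ j → S j ≟X c) ≤ 1
  count-fibre≤1 {zero}  S inj c = z≤n
  count-fibre≤1 {suc n} S inj c with S zero ≟X c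
  ... | no _     = count-fibre≤1 (S ∘ suc) (suc-injective ∘ inj) c
  ... | yes refl = s≤s (≤-reflexive (trans (sum-cong-≗ (λ j → 𝟙-no (S (suc j) ≟X c) λ eq → 0≢1+n (sym (inj eq)))) (trans (∑-const n 0) (*-zeroʳ n))))

  -- By injectivity of `S` each used colour spoils at most one position; the pairs of a position and
  -- a used colour are counted in both orders.
  count-avoiding : ∀ {n} {P : Fin n → Set} (P? : ∀ j → Dec (P j))
    (S : Fin n → X) → Injective _≡_ _≡_ S →
    ∀ {a} (used : Fin a → X) (avoid? : ∀ j → Dec (P j × (∀ u → S j ≢ used u))) →
    count P? ≤ count avoid? + a
  count-avoiding P? S inj {a} used avoid? = begin
    count P?
      ≤⟨ ∑-mono pointwise ⟩
    ∑ (λ j → 𝟙 (avoid? j) + ∑ λ u → 𝟙 (S j ≟X used u))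
      ≡⟨ ∑-distrib-+ (λ j → 𝟙 (avoid? j)) _ ⟩
    count avoid? + ∑ (λ j → ∑ λ u → 𝟙 (S j ≟X used u))
      ≡⟨ cong (count avoid? +_) (∑-comm (λ j u → 𝟙 (S j ≟X used u))) ⟩
    count avoid? + ∑ (λ u → count λ j → S j ≟X used u)
      ≤⟨ +-monoʳ-≤ (count avoid?) (∑-mono (λ u → count-fibre≤1 S inj (used u))) ⟩
    count avoid? + ∑ {a} (λ _ → 1)
      ≡⟨ cong (count avoid? +_) (trans (∑-const a 1) (*-identityʳ a)) ⟩
    count avoid? + a ∎
    where
    open ≤-Reasoning
    pointwise : ∀ j → 𝟙 (P? j) ≤ 𝟙 (avoid? j) + ∑ λ u → 𝟙 (S j ≟X used u)
    pointwise j with P? j | avoid? j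
    ... | no _  | _     = z≤n
    ... | yes _ | yes _ = s≤s z≤n
    -- `¬a` names no used colour equal to `S j`, so the number of such colours is inspected: were it
    -- zero, `j` would avoid them all.
    ... | yes p | no ¬a with ∑ (λ u → 𝟙 (S j ≟X used u)) in eq
    ...   | suc _ = s≤s z≤n
    ...   | zero  = contradiction (p , λ u Sj≡u → 1+n≢0 (n≤0⇒n≡0 (begin
                      1                                 ≡⟨ 𝟙-yes (S j ≟X used u) Sj≡u ⟨
                      𝟙 (S j ≟X used u)                 ≤⟨ term≤∑ (λ u → 𝟙 (S j ≟X used u)) u ⟩
                      ∑ (λ u → 𝟙 (S j ≟X used u))       ≡⟨ eq ⟩
                      0                                 ∎))) ¬a

-- Greedy choice of pairwise disjoint sets.

module _ {V X : Set} (_≟V_ : DecidableEquality V) (_≟X_ : DecidableEquality X)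
         {n k : ℕ} (S : V → Fin n → X) (S-inj : ∀ v → Injective _≡_ _≡_ (S v))
         {Q : V → Fin n → Set} (Q? : ∀ v j → Dec (Q v j)) where

  -- Disjointness is asked of every two distinct vertices of `vs`, whatever their classes. Outside
  -- `vs` the values of `C` are placeholders.
  DisjointChoice : List V → (V → Fin k → Fin n) → Set
  DisjointChoice vs C =
    (∀ {v} → v ∈ vs → Injective _≡_ _≡_ (C v) × (∀ i → Q v (C v i))) ×
    (∀ {u v} → u ∈ vs → v ∈ vs → u ≢ v → ∀ i j → S u (C u i) ≢ S v (C v j))

  -- The vertices of `vs` block at most `length vs * k` positions of `v`, so `k` admissible ones are
  -- left.
  extendChoice : ∀ {v vs C} → suc (length vs) * k ≤ count (Q? v) →
    DisjointChoice vs C → ∃[ C′ ] DisjointChoice (v ∷ vs) C′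
  extendChoice {v} {vs} {C} enough (own , apart) = C′ , own′ , apart′
    where
    colour : Fin (length vs) × Fin k → X
    colour (q , i) = S (lookup vs q) (C (lookup vs q) i)
    used : Fin (length vs * k) → X
    used p = colour (remQuot k p)
    avoid? : ∀ j → Dec (Q v j × (∀ p → S v j ≢ used p))
    avoid? j = Q? v j ×-dec all? (λ p → ¬? (S v j ≟X used p))
    new = select avoid? k (+-cancelʳ-≤ (length vs * k) _ _ (let open ≤-Reasoning in begin
      k + length vs * k              ≤⟨ enough ⟩
      count (Q? v)                   ≤⟨ count-avoiding _≟X_ (Q? v) (S v) (S-inj v) used avoid? ⟩
      count avoid? + length vs * k   ∎))
    D = proj₁ new
    -- If `v` already occurs in `vs`, its earlier choice is overwritten.
    C′ : V → Fin k → Fin n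
    C′ u with u ≟V v
    ... | yes _ = D
    ... | no _  = C u
    fresh : ∀ {u} → u ∈ vs → ∀ i j → S v (D j) ≢ S u (C u i)
    fresh {u} u∈ i j eq = proj₂ (proj₂ (proj₂ new) j) (combine (index u∈) i) (begin
      S v (D j)                       ≡⟨ eq ⟩
      S u (C u i)                     ≡⟨ cong (λ x → S x (C x i)) (lookup-index u∈) ⟩
      colour (index u∈ , i)           ≡⟨ cong colour (remQuot-combine (index u∈) i) ⟨
      used (combine (index u∈) i)     ∎)
      where open ≡-Reasoning
    own′ : ∀ {u} → u ∈ v ∷ vs → Injective _≡_ _≡_ (C′ u) × (∀ i → Q u (C′ u i))
    own′ {u} u∈ with u ≟V v | u∈
    ... | yes refl | _          = proj₁ (proj₂ new) , λ i → proj₁ (proj₂ (proj₂ new) i)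
    ... | no u≢v   | here u≡v   = contradiction u≡v u≢v
    ... | no _     | there u∈vs = own u∈vs
    apart′ : ∀ {u w} → u ∈ v ∷ vs → w ∈ v ∷ vs → u ≢ w → ∀ i j → S u (C′ u i) ≢ S w (C′ w j)
    apart′ {u} {w} u∈ w∈ u≢w i j with u ≟V v | w ≟V v | u∈ | w∈
    ... | yes refl | yes refl | _        | _        = λ _ → u≢w refl
    ... | yes refl | no w≢v   | _        | here eq  = λ _ → w≢v eq
    ... | yes refl | no _     | _        | there w∈ = fresh w∈ j i
    ... | no u≢v   | _        | here eq  | _        = λ _ → u≢v eq
    ... | no _     | yes refl | there u∈ | _        = λ eq → fresh u∈ i j (sym eq)
    ... | no _     | no w≢v   | there _  | here eq  = λ _ → w≢v eq
    ... | no _     | no _     | there u∈ | there w∈ = apart u∈ w∈ u≢w i j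

  -- The head is served last and has to avoid the colours of the whole tail. `C₀` only fills in
  -- values outside the list.
  greedyChoice : (V → Fin k → Fin n) → ∀ vs → (∀ {v} → v ∈ vs → length vs * k ≤ count (Q? v)) →
                 ∃[ C ] DisjointChoice vs C
  greedyChoice C₀ []       _      = C₀ , (λ ()) , (λ ())
  greedyChoice C₀ (v ∷ vs) enough =
    extendChoice (enough (here refl))
      (proj₂ (greedyChoice C₀ vs λ u∈ → ≤-trans (m≤n+m _ k) (enough (there u∈))))

-- Averaging over random assignments of colours to classes.

argmin : ∀ {n} (g : Fin (suc n) → ℕ) → ∃[ x ] (∀ y → g x ≤ g y)
argmin {zero}  g = zero , λ { zero → ≤-refl }
argmin {suc n} g with argmin (g ∘ suc)
... | x , gx≤ with ≤-total (g zero) (g (suc x))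
...   | inj₁ g0≤gx = zero , λ { zero → ≤-refl ; (suc y) → ≤-trans g0≤gx (gx≤ y) }
...   | inj₂ gx≤g0 = suc x , λ { zero → gx≤g0 ; (suc y) → gx≤ y }

-- The method of conditional expectations: f is chosen one colour at a time.
average : ∀ {N B R} (w : Fin (suc R) → ℕ) (A : Fin N → ℕ) (F : Fin N → Fin B → Fin (suc R) → ℕ) →
  Σ (Fin B → Fin (suc R)) λ f →
    ∑ w ^ B * ∑ (λ v → A v * ∏ λ c → F v c (f c)) ≤ ∑ (λ v → A v * ∏ λ c → ∑ λ x → w x * F v c x)
average {B = zero}  w A F = (λ ()) , ≤-reflexive (*-identityˡ _)
average {N} {suc B} {R} w A F = f , (begin
  W * W ^ B * ∑ (λ v → A v * (F v zero x * ∏ λ c → F v (suc c) (f′ c)))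
    ≡⟨ *-assoc W (W ^ B) _ ⟩
  W * (W ^ B * ∑ (λ v → A v * (F v zero x * ∏ λ c → F v (suc c) (f′ c))))
    ≡⟨ cong (λ s → W * (W ^ B * s)) (sum-cong-≗ λ v → *-assoc (A v) (F v zero x) _) ⟨
  W * (W ^ B * ∑ (λ v → A v * F v zero x * ∏ λ c → F v (suc c) (f′ c)))
    ≤⟨ *-monoʳ-≤ W (proj₂ rec) ⟩
  W * g x
    ≡⟨ *-distribʳ-sum (g x) w ⟩
  ∑ (λ y → w y * g x)
    ≤⟨ ∑-mono (λ y → *-monoʳ-≤ (w y) (gx≤ y)) ⟩
  ∑ (λ y → w y * g y)
    ≡⟨ sum-cong-≗ (λ y → *-distribˡ-sum (w y) λ v → A v * F v zero y * G v) ⟩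
  ∑ (λ y → ∑ λ v → w y * (A v * F v zero y * G v))
    ≡⟨ ∑-comm (λ y v → w y * (A v * F v zero y * G v)) ⟩
  ∑ (λ v → ∑ λ y → w y * (A v * F v zero y * G v))
    ≡⟨ sum-cong-≗ factor ⟩
  ∑ (λ v → A v * (∑ (λ y → w y * F v zero y) * G v)) ∎)
  where
  open ≤-Reasoning
  W = ∑ w
  G : Fin N → ℕ
  G v = ∏ λ c → ∑ λ y → w y * F v (suc c) y
  -- Up to normalisation, `g y` is the expected total when the first colour receives `y` and the
  -- others are still random.
  g : Fin (suc R) → ℕ
  g y = ∑ λ v → A v * F v zero y * G v
  x = proj₁ (argmin g)
  gx≤ = proj₂ (argmin g)
  -- The factor of the colour just fixed is merged into the weights; this is why `A` is arbitrary in
  -- the statement.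
  rec = average w (λ v → A v * F v zero x) (λ v c → F v (suc c))
  f′ = proj₁ rec
  f : Fin (suc B) → Fin (suc R)
  f zero    = x
  f (suc c) = f′ c
  rearrange : ∀ a b c d → a * (b * c * d) ≡ b * (a * c * d)
  rearrange = solve-∀
  factor : ∀ v → ∑ (λ y → w y * (A v * F v zero y * G v)) ≡ A v * (∑ (λ y → w y * F v zero y) * G v)
  factor v = begin-equality
    ∑ (λ y → w y * (A v * F v zero y * G v))     ≡⟨ sum-cong-≗ (λ y → rearrange (w y) (A v) (F v zero y) (G v)) ⟩
    ∑ (λ y → A v * (w y * F v zero y * G v))     ≡⟨ *-distribˡ-sum (A v) (λ y → w y * F v zero y * G v) ⟨
    A v * ∑ (λ y → w y * F v zero y * G v)       ≡⟨ cong (A v *_) (*-distribʳ-sum (G v) λ y → w y * F v zero y) ⟨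
    A v * (∑ (λ y → w y * F v zero y) * G v)     ∎

∏-^-𝟙 : ∀ {B} (g : Fin B → ℕ) s → ∏ (λ c → g c ^ 𝟙 (s ≟ c)) ≡ g s
∏-^-𝟙 {suc B} g zero    = begin
  g zero * 1 * ∏ {B} (λ _ → 1)  ≡⟨ cong₂ _*_ (*-identityʳ (g zero)) (trans (∏-const B 1) (^-zeroˡ B)) ⟩
  g zero * 1                    ≡⟨ *-identityʳ (g zero) ⟩
  g zero                        ∎
  where open ≡-Reasoning
∏-^-𝟙 {suc B} g (suc s) = trans (*-identityˡ _) (∏-^-𝟙 (g ∘ suc) s)

∑-𝟙 : ∀ {B} (s : Fin B) → ∑ (λ c → 𝟙 (s ≟ c)) ≡ 1
∑-𝟙 {suc B} zero    = cong suc (trans (∑-const B 0) (*-zeroʳ B))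
∑-𝟙 {suc B} (suc s) = ∑-𝟙 s

module _ {n B : ℕ} (S : Fin n → Fin B) where

  multiplicity : Fin B → ℕ
  multiplicity c = count (λ j → S j ≟ c)

  ∑-multiplicity : ∑ multiplicity ≡ n
  ∑-multiplicity = begin
    ∑ (λ c → ∑ λ j → 𝟙 (S j ≟ c))   ≡⟨ ∑-comm (λ c j → 𝟙 (S j ≟ c)) ⟩
    ∑ (λ j → ∑ λ c → 𝟙 (S j ≟ c))   ≡⟨ sum-cong-≗ (λ j → ∑-𝟙 (S j)) ⟩
    ∑ {n} (λ _ → 1)                 ≡⟨ ∑-const n 1 ⟩
    n * 1                           ≡⟨ *-identityʳ n ⟩
    n                               ∎
    where open ≡-Reasoning

  -- Turns a product along a list into a product over all colours, the shape that `average` takes;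
  -- absent colours contribute a zeroth power.
  ∏-^-multiplicity : (g : Fin B → ℕ) → ∏ (λ c → g c ^ multiplicity c) ≡ ∏ (λ j → g (S j))
  ∏-^-multiplicity g = begin
    ∏ (λ c → g c ^ multiplicity c)            ≡⟨ ∏-cong (λ c → ∏-^-∑ (g c) (λ j → 𝟙 (S j ≟ c))) ⟨
    ∏ (λ c → ∏ λ j → g c ^ 𝟙 (S j ≟ c))       ≡⟨ ∏-comm (λ c j → g c ^ 𝟙 (S j ≟ c)) ⟩
    ∏ (λ j → ∏ λ c → g c ^ 𝟙 (S j ≟ c))       ≡⟨ ∏-cong (λ j → ∏-^-𝟙 g (S j)) ⟩
    ∏ (λ j → g (S j))                         ∎
    where open ≡-Reasoning

  -- Independence of the colours. An absent colour contributes the total weight W and a present one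
  -- the weighted sum E; the padding by `W ^ n` gives each present colour the missing W and avoids
  -- the difference B - n.
  ∏-averages : Injective _≡_ _≡_ S → ∀ {R} (w φ : Fin R → ℕ) →
    ∑ w ^ n * ∏ (λ c → ∑ λ x → w x * φ x ^ multiplicity c) ≡ ∑ w ^ B * ∑ (λ x → w x * φ x) ^ n
  ∏-averages S-inj w φ = begin
    W ^ n * ∏ avg                                   ≡⟨ cong (λ e → W ^ e * ∏ avg) ∑-multiplicity ⟨
    W ^ ∑ multiplicity * ∏ avg                      ≡⟨ cong (_* ∏ avg) (∏-^-∑ W multiplicity) ⟨
    ∏ (λ c → W ^ multiplicity c) * ∏ avg            ≡⟨ ∏-distrib-* (λ c → W ^ multiplicity c) avg ⟨
    ∏ (λ c → W ^ multiplicity c * avg c)            ≡⟨ ∏-cong (λ c → balance (multiplicity c) (count-fibre≤1 _≟_ S S-inj c)) ⟩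
    ∏ (λ c → W * E ^ multiplicity c)                ≡⟨ ∏-distrib-* (λ _ → W) (λ c → E ^ multiplicity c) ⟩
    ∏ {B} (λ _ → W) * ∏ (λ c → E ^ multiplicity c)  ≡⟨ cong₂ _*_ (∏-const B W) (∏-^-∑ E multiplicity) ⟩
    W ^ B * E ^ ∑ multiplicity                      ≡⟨ cong (λ e → W ^ B * E ^ e) ∑-multiplicity ⟩
    W ^ B * E ^ n                                   ∎
    where
    open ≡-Reasoning
    W = ∑ w
    E = ∑ λ x → w x * φ x
    avg : Fin B → ℕ
    avg c = ∑ λ x → w x * φ x ^ multiplicity c
    -- Injectivity enters here: the average of a square need not be the square of the average.
    balance : ∀ e → e ≤ 1 → W ^ e * ∑ (λ x → w x * φ x ^ e) ≡ W * E ^ e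
    balance 0 _ = trans (*-identityˡ _) (trans (sum-cong-≗ (λ x → *-identityʳ (w x))) (sym (*-identityʳ W)))
    balance 1 _ = cong₂ _*_ (*-identityʳ W) (trans (sum-cong-≗ (λ x → cong (w x *_) (*-identityʳ (φ x)))) (sym (*-identityʳ E)))
    balance (suc (suc _)) (s≤s ())

-- Conditional expectations for penalties multiplied along lists. After `∑ w ^ B` cancels, the bound
-- depends on the list length but not on the number of colours.
average-lists : ∀ {N n B R} (w : Fin (suc R) → ℕ) .{{_ : NonZero (∑ w)}} (A : Fin N → ℕ)
  (φ : Fin N → Fin (suc R) → ℕ) (S : Fin N → Fin n → Fin B) → (∀ v → Injective _≡_ _≡_ (S v)) →
  Σ (Fin B → Fin (suc R)) λ f →
    ∑ w ^ n * ∑ (λ v → A v * ∏ λ j → φ v (f (S v j))) ≤ ∑ (λ v → A v * ∑ (λ x → w x * φ v x) ^ n)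
average-lists {N} {n} {B} {R} w A φ S S-inj = f , *-cancelˡ-≤ (W ^ B) {{m^n≢0 W B}} (begin
  W ^ B * (W ^ n * ∑ (λ v → A v * H v))
    ≡⟨ swap (W ^ B) (W ^ n) (∑ λ v → A v * H v) ⟩
  W ^ n * (W ^ B * ∑ (λ v → A v * H v))
    ≡⟨ cong (λ s → W ^ n * (W ^ B * s)) (sum-cong-≗ λ v → cong (A v *_) (∏-^-multiplicity (S v) (λ c → φ v (f c)))) ⟨
  W ^ n * (W ^ B * ∑ (λ v → A v * ∏ λ c → F v c (f c)))
    ≤⟨ *-monoʳ-≤ (W ^ n) (proj₂ avg) ⟩
  W ^ n * ∑ (λ v → A v * P v)
    ≡⟨ *-distribˡ-sum (W ^ n) (λ v → A v * P v) ⟩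
  ∑ (λ v → W ^ n * (A v * P v))
    ≡⟨ sum-cong-≗ (λ v → swap (W ^ n) (A v) (P v)) ⟩
  ∑ (λ v → A v * (W ^ n * P v))
    ≡⟨ sum-cong-≗ (λ v → cong (A v *_) (∏-averages (S v) (S-inj v) w (φ v))) ⟩
  ∑ (λ v → A v * (W ^ B * E v ^ n))
    ≡⟨ sum-cong-≗ (λ v → swap (A v) (W ^ B) (E v ^ n)) ⟩
  ∑ (λ v → W ^ B * (A v * E v ^ n))
    ≡⟨ *-distribˡ-sum (W ^ B) (λ v → A v * E v ^ n) ⟨
  W ^ B * ∑ (λ v → A v * E v ^ n) ∎)
  where
  open ≤-Reasoning
  W = ∑ w
  F : Fin N → Fin B → Fin (suc R) → ℕ
  F v c x = φ v x ^ multiplicity (S v) c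
  avg = average w A F
  f = proj₁ avg
  H P E : Fin N → ℕ
  H v = ∏ λ j → φ v (f (S v j))
  P v = ∏ λ c → ∑ λ x → w x * F v c x
  E v = ∑ λ x → w x * φ v x
  swap : ∀ a b c → a * (b * c) ≡ b * (a * c)
  swap = solve-∀

-- From a cheap colouring of the colours to a choice.

∑[]-both : {I J : Set} (p q : I → J) (xs : List I) (g : J → ℕ) →
  ∑[ foldr (λ x ys → p x ∷ q x ∷ ys) [] xs ] g ≡ ∑[ xs ] (λ x → g (p x) + g (q x))
∑[]-both p q []       g = refl
∑[]-both p q (x ∷ xs) g = trans (sym (+-assoc (g (p x)) (g (q x)) _)) (cong (g (p x) + g (q x) +_) (∑[]-both p q xs g))

-- Markov's inequality in counting form.
length-filter*≤∑[] : {I : Set} {P : I → Set} (P? : ∀ x → Dec (P x)) (c : ℕ) (g : I → ℕ) →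
  (∀ x → P x → c ≤ g x) → ∀ xs → length (filter P? xs) * c ≤ ∑[ xs ] g
length-filter*≤∑[] P? c g c≤g []       = z≤n
length-filter*≤∑[] P? c g c≤g (x ∷ xs) with P? x
... | yes p = +-mono-≤ (c≤g x p) (length-filter*≤∑[] P? c g c≤g xs)
... | no  _ = ≤-trans (length-filter*≤∑[] P? c g c≤g xs) (m≤n+m _ (g x))

-- Twice 2^(-hit): along a list of length n the product is 2^(n - hits), an exponential moment of
-- the number of hits that stays integral.
penalty : ∀ {R} → Fin R → Fin R → ℕ
penalty x y = if does (x ≟ y) then 1 else 2

2^count*∏-penalty : ∀ {n R} (x : Fin R) (h : Fin n → Fin R) →
  2 ^ count (λ j → x ≟ h j) * ∏ (λ j → penalty x (h j)) ≡ 2 ^ n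
2^count*∏-penalty {zero}  x h = refl
2^count*∏-penalty {suc n} x h with ih ← 2^count*∏-penalty x (h ∘ suc) | x ≟ h zero
... | yes _ = trans (lemma (2 ^ count (λ j → x ≟ h (suc j))) (∏ λ j → penalty x (h (suc j)))) (cong (2 *_) ih)
  where
  lemma : ∀ a b → 2 * a * (1 * b) ≡ 2 * (a * b)
  lemma = solve-∀
... | no _  = trans (lemma (2 ^ count (λ j → x ≟ h (suc j))) (∏ λ j → penalty x (h (suc j)))) (cong (2 *_) ih)
  where
  lemma : ∀ a b → a * (2 * b) ≡ 2 * (a * b)
  lemma = solve-∀

∑-*-𝟙 : ∀ {R} (w : Fin R → ℕ) x → ∑ (λ y → w y * 𝟙 (x ≟ y)) ≡ w x
∑-*-𝟙 {suc R} w zero = begin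
  w zero * 1 + ∑ (λ y → w (suc y) * 0)  ≡⟨ cong₂ _+_ (*-identityʳ (w zero)) (sum-cong-≗ (λ y → *-zeroʳ (w (suc y)))) ⟩
  w zero + ∑ {R} (λ _ → 0)              ≡⟨ cong (w zero +_) (trans (∑-const R 0) (*-zeroʳ R)) ⟩
  w zero + 0                            ≡⟨ +-identityʳ (w zero) ⟩
  w zero                                ∎
  where open ≡-Reasoning
∑-*-𝟙 {suc R} w (suc x) = trans (cong (_+ ∑ λ y → w (suc y) * 𝟙 (x ≟ y)) (*-zeroʳ (w zero))) (∑-*-𝟙 (w ∘ suc) x)

-- The weighted penalty total is 2W - w x, stated without subtraction to match the base y + w of the
-- decay estimate.
∑-*-penalty : ∀ {R} (w : Fin R → ℕ) x → ∑ (λ y → w y * penalty x y) + w x ≡ 2 * ∑ w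
∑-*-penalty w x = begin
  ∑ (λ y → w y * penalty x y) + w x                         ≡⟨ cong (∑ (λ y → w y * penalty x y) +_) (∑-*-𝟙 w x) ⟨
  ∑ (λ y → w y * penalty x y) + ∑ (λ y → w y * 𝟙 (x ≟ y))   ≡⟨ ∑-distrib-+ (λ y → w y * penalty x y) (λ y → w y * 𝟙 (x ≟ y)) ⟨
  ∑ (λ y → w y * penalty x y + w y * 𝟙 (x ≟ y))             ≡⟨ sum-cong-≗ pointwise ⟩
  ∑ (λ y → 2 * w y)                                         ≡⟨ *-distribˡ-sum 2 w ⟨
  2 * ∑ w                                                   ∎
  where
  open ≡-Reasoning
  hit : ∀ a → a * 1 + a * 1 ≡ 2 * a
  hit = solve-∀
  miss : ∀ a → a * 2 + a * 0 ≡ 2 * a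
  miss = solve-∀
  pointwise : ∀ y → w y * penalty x y + w y * 𝟙 (x ≟ y) ≡ 2 * w y
  pointwise y with x ≟ y
  ... | yes _ = hit (w y)
  ... | no _  = miss (w y)

module _ {V : Set} (_≟V_ : DecidableEquality V) (vs : List V) (vs-complete : ∀ v → v ∈ vs)
         {r : ℕ} (κ : V → Fin r) {n B : ℕ} (S : V → Fin n → Fin B) (S-inj : ∀ v → Injective _≡_ _≡_ (S v))
         (k : ℕ) (k≤n : k ≤ n) (w : Fin (suc r) → ℕ) .{{_ : NonZero (∑ w)}} where

  private
    W = ∑ w
    a : Fin (suc r) → ℕ
    a x = ∑ λ y → w y * penalty x y

  ClassChoice : Set
  ClassChoice = Σ (V → Fin k → Fin n) λ C →
    (∀ v → Injective _≡_ _≡_ (C v)) × (∀ u v → κ u ≢ κ v → ∀ i j → S u (C u i) ≢ S v (C v j))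

  -- Taken with `p` the products of penalties, the first summand reaches `2 ^ n` when a vertex sees
  -- fewer than `k` own colours, and the second reaches `suc r * 2 ^ n` when it sees fewer than
  -- `r * k` reserve colours. A total of at most `r * 2 ^ n` thus allows at most `r` bad vertices
  -- and no short reserve.
  cost : (Fin (suc r) → ℕ) → V → ℕ
  cost p v = 2 ^ k * p (suc (κ v)) + suc r * 2 ^ (r * k) * p zero

  cheapColouring : ∑[ vs ] (cost λ x → a x ^ n) ≤ r * (2 * W) ^ n →
    Σ (Fin B → Fin (suc r)) λ f → ∑[ vs ] (λ v → cost (λ x → ∏ λ j → penalty x (f (S v j))) v) ≤ r * 2 ^ n
  cheapColouring hyp = f , *-cancelˡ-≤ (W ^ n) {{m^n≢0 W n}} (begin
    W ^ n * ∑[ vs ] (λ v → cost (λ x → ∏ λ j → penalty x (f (S v j))) v)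
      ≡⟨ cong (W ^ n *_) (∑[]-both own reserved vs value) ⟨
    W ^ n * ∑[ items ] value
      ≤⟨ proj₂ avg ⟩
    ∑[ items ] (λ (A , _ , x) → A * a x ^ n)
      ≡⟨ ∑[]-both own reserved vs (λ (A , _ , x) → A * a x ^ n) ⟩
    ∑[ vs ] (cost λ x → a x ^ n)
      ≤⟨ hyp ⟩
    r * (2 * W) ^ n
      ≡⟨ cong (r *_) (^-distribʳ-* n 2 W) ⟩
    r * (2 ^ n * W ^ n)
      ≡⟨ rearrange r (2 ^ n) (W ^ n) ⟩
    W ^ n * (r * 2 ^ n) ∎)
    where
    open ≤-Reasoning
    -- Each vertex yields two items, made of a weight, the vertex and the class watched. Averaging
    -- all of them together gives a single `f` for both requirements.
    own reserved : V → ℕ × V × Fin (suc r)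
    own v      = 2 ^ k , v , suc (κ v)
    reserved v = suc r * 2 ^ (r * k) , v , zero
    items = foldr (λ v ys → own v ∷ reserved v ∷ ys) [] vs
    avg = average-lists w (proj₁ ∘ lookup items) (penalty ∘ proj₂ ∘ proj₂ ∘ lookup items)
            (S ∘ proj₁ ∘ proj₂ ∘ lookup items) (S-inj ∘ proj₁ ∘ proj₂ ∘ lookup items)
    f = proj₁ avg
    value : ℕ × V × Fin (suc r) → ℕ
    value (A , v , x) = A * ∏ λ j → penalty x (f (S v j))
    rearrange : ∀ x y z → x * (y * z) ≡ z * (x * y)
    rearrange = solve-∀

  -- The value of `f` separates own colours of different classes from each other and from the
  -- reserve. Only two bad vertices could clash, and the greedy choice on `bads` keeps these apart.
  classChoice : ∑[ vs ] (cost λ x → a x ^ n) ≤ r * (2 * W) ^ n → ClassChoice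
  classChoice hyp with cheapColouring hyp
  ... | f , cheap = C , C-inj , C-apart
    where
    open ≤-Reasoning
    hit? : ∀ x v j → Dec (x ≡ f (S v j))
    hit? x v j = x ≟ f (S v j)
    p : V → Fin (suc r) → ℕ
    p v x = ∏ λ j → penalty x (f (S v j))
    few-hits : ∀ x v l → ¬ (l ≤ count (hit? x v)) → 2 ^ n ≤ 2 ^ l * p v x
    few-hits x v l l≰ = begin
      2 ^ n                          ≡⟨ 2^count*∏-penalty x (λ j → f (S v j)) ⟨
      2 ^ count (hit? x v) * p v x   ≤⟨ *-monoˡ-≤ (p v x) (^-monoʳ-≤ 2 (<⇒≤ (≰⇒> l≰))) ⟩
      2 ^ l * p v x                  ∎
    reserve-large : ∀ v → r * k ≤ count (hit? zero v)
    reserve-large v with r * k ≤? count (hit? zero v)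
    ... | yes rk≤ = rk≤
    ... | no rk≰  = contradiction (begin
      suc r * 2 ^ n                            ≤⟨ *-monoʳ-≤ (suc r) (few-hits zero v (r * k) rk≰) ⟩
      suc r * (2 ^ (r * k) * p v zero)         ≡⟨ *-assoc (suc r) (2 ^ (r * k)) (p v zero) ⟨
      suc r * 2 ^ (r * k) * p v zero           ≤⟨ m≤n+m _ _ ⟩
      cost (p v) v                             ≤⟨ term≤∑[] (λ u → cost (p u) u) (vs-complete v) ⟩
      ∑[ vs ] (λ u → cost (p u) u)             ≤⟨ cheap ⟩
      r * 2 ^ n                                ∎) (<⇒≱ (*-monoˡ-< (2 ^ n) {{m^n≢0 2 n}} (n<1+n r)))
    good? : ∀ v → Dec (k ≤ count (hit? (suc (κ v)) v))
    good? v = k ≤? count (hit? (suc (κ v)) v)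
    bad? : ∀ v → Dec (¬ (k ≤ count (hit? (suc (κ v)) v)))
    bad? v = ¬? (good? v)
    bads = filter bad? vs
    few-bads : length bads ≤ r
    few-bads = *-cancelʳ-≤ _ _ (2 ^ n) {{m^n≢0 2 n}} (≤-trans
      (length-filter*≤∑[] bad? (2 ^ n) (λ u → cost (p u) u)
        (λ u bad → ≤-trans (few-hits (suc (κ u)) u k bad) (m≤m+n _ _)) vs)
      cheap)
    -- `inject≤` is a placeholder for vertices outside `bads`, which take colours of their own
    -- class.
    greedy = greedyChoice _≟V_ _≟_ S S-inj (hit? zero) (λ _ i → inject≤ i k≤n) bads
      (λ {v} _ → ≤-trans (*-monoˡ-≤ k few-bads) (reserve-large v))
    choice : ∀ v → Dec (k ≤ count (hit? (suc (κ v)) v)) → Fin k → Fin n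
    choice v (yes good) = proj₁ (select (hit? (suc (κ v)) v) k good)
    choice v (no _)     = proj₁ greedy v
    C : V → Fin k → Fin n
    C v = choice v (good? v)
    ∈bads : ∀ {v} → ¬ (k ≤ count (hit? (suc (κ v)) v)) → v ∈ bads
    ∈bads bad = ∈-filter⁺ bad? (vs-complete _) bad
    choice-inj : ∀ v d → Injective _≡_ _≡_ (choice v d)
    choice-inj v (yes good) = proj₁ (proj₂ (select (hit? (suc (κ v)) v) k good))
    choice-inj v (no bad)   = proj₁ (proj₁ (proj₂ greedy) (∈bads bad))
    C-inj : ∀ v → Injective _≡_ _≡_ (C v)
    C-inj v = choice-inj v (good? v)
    own-colour : ∀ v good i → suc (κ v) ≡ f (S v (choice v (yes good) i))
    own-colour v good = proj₂ (proj₂ (select (hit? (suc (κ v)) v) k good))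
    reserve-colour : ∀ v bad i → zero ≡ f (S v (choice v (no bad) i))
    reserve-colour v bad = proj₂ (proj₁ (proj₂ greedy) (∈bads bad))
    choice-apart : ∀ u v d e → κ u ≢ κ v → ∀ i j → S u (choice u d i) ≢ S v (choice v e j)
    choice-apart u v (yes gu) (yes gv) κ≢ i j eq =
      κ≢ (suc-injective (trans (own-colour u gu i) (trans (cong f eq) (sym (own-colour v gv j)))))
    choice-apart u v (yes gu) (no bv) κ≢ i j eq =
      0≢1+n (trans (reserve-colour v bv j) (trans (cong f (sym eq)) (sym (own-colour u gu i))))
    choice-apart u v (no bu) (yes gv) κ≢ i j eq =
      0≢1+n (trans (reserve-colour u bu i) (trans (cong f eq) (sym (own-colour v gv j))))
    choice-apart u v (no bu) (no bv) κ≢ i j =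
      proj₂ (proj₂ greedy) (∈bads bu) (∈bads bv) (λ u≡v → κ≢ (cong κ u≡v)) i j
    C-apart : ∀ u v → κ u ≢ κ v → ∀ i j → S u (C u i) ≢ S v (C v j)
    C-apart u v = choice-apart u v (good? u) (good? v)

-- Enumeration of the vertices; binary size of a class.

∑[]-++ : {I : Set} (xs ys : List I) (g : I → ℕ) → ∑[ xs ++ ys ] g ≡ ∑[ xs ] g + ∑[ ys ] g
∑[]-++ []       ys g = refl
∑[]-++ (x ∷ xs) ys g = trans (cong (g x +_) (∑[]-++ xs ys g)) (sym (+-assoc (g x) _ _))

∑[]-tabulate : {I : Set} → ∀ {n} (f : Fin n → I) (g : I → ℕ) → ∑[ List.tabulate f ] g ≡ ∑ (g ∘ f)
∑[]-tabulate {n = zero}  f g = refl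
∑[]-tabulate {n = suc n} f g = cong (g (f zero) +_) (∑[]-tabulate (f ∘ suc) g)

∑[]-concat-tabulate : {I : Set} → ∀ {n} (f : Fin n → List I) (g : I → ℕ) →
  ∑[ concat (List.tabulate f) ] g ≡ ∑ (λ i → ∑[ f i ] g)
∑[]-concat-tabulate {n = zero}  f g = refl
∑[]-concat-tabulate {n = suc n} f g =
  trans (∑[]-++ (f zero) _ g) (cong (∑[ f zero ] g +_) (∑[]-concat-tabulate (f ∘ suc) g))

sum-tabulate : ∀ {n} (m : Fin n → ℕ) → sum (tabulate m) ≡ ∑ m
sum-tabulate {zero}  m = refl
sum-tabulate {suc n} m = cong (m zero +_) (sum-tabulate (m ∘ suc))

module _ {r : ℕ} (m : Fin r → ℕ) where

  vertices : List (KVertex r m)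
  vertices = concat (List.tabulate λ i → List.tabulate λ a → i , a)

  ∈-vertices : ∀ v → v ∈ vertices
  ∈-vertices (i , a) = ∈-concat⁺′ (∈-tabulate⁺ {f = i ,_} a) (∈-tabulate⁺ i)

  ∑-vertices : (g : Fin r → ℕ) → ∑[ vertices ] (g ∘ proj₁) ≡ ∑ (λ i → m i * g i)
  ∑-vertices g = trans (∑[]-concat-tabulate (λ i → List.tabulate (i ,_)) (g ∘ proj₁))
    (sum-cong-≗ {r} λ i → trans (∑[]-tabulate {KVertex r m} {m i} (i ,_) (g ∘ proj₁)) (∑-const (m i) (g i)))

  _≟V_ : DecidableEquality (KVertex r m)
  _≟V_ = ≡-dec _≟_ _≟_

-- With quotient q, m < (q + 1) * 2 ^ L and q + 1 ≤ 2 ^ q. The exponent exceeds L by at most m / 2 ^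
-- L, so its sum over the classes is controlled by their total size.
m<2^[L+m/2^L] : ∀ m L → m < 2 ^ (L + _/_ m (2 ^ L) {{m^n≢0 2 L}})
m<2^[L+m/2^L] m L = begin-strict
  m                        ≡⟨ m≡m%n+[m/n]*n m (2 ^ L) ⟩
  m % 2 ^ L + q * 2 ^ L    <⟨ +-monoˡ-< (q * 2 ^ L) (m%n<n m (2 ^ L)) ⟩
  suc q * 2 ^ L            ≤⟨ *-monoˡ-≤ (2 ^ L) (n<2^n q) ⟩
  2 ^ q * 2 ^ L            ≡⟨ *-comm (2 ^ q) (2 ^ L) ⟩
  2 ^ L * 2 ^ q            ≡⟨ ^-distribˡ-+-* 2 L q ⟨
  2 ^ (L + q)              ∎
  where
  open ≤-Reasoning
  instance 2^L≢0 = m^n≢0 2 L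
  q = m / 2 ^ L

-- Choice of weights and the expected cost.

module _ {r : ℕ} (1≤r : 1 ≤ r) (m : Fin r → ℕ) {k : ℕ} (1≤k : 1 ≤ k) {L : ℕ} (1≤L : 1 ≤ L)
         (m-small : ∑ m < r * 2 ^ suc L) where

  private
    instance 2^L≢0 = m^n≢0 2 L
    open ≤-Reasoning

    l : Fin r → ℕ
    l i = L + m i / 2 ^ L
    Z = r * (k + 3 * L)
    w : Fin (suc r) → ℕ
    w zero    = Z
    w (suc i) = k + l i
    W = ∑ w

  ∑-quotients : ∑ (λ i → m i / 2 ^ L) ≤ r * 2
  ∑-quotients = *-cancelʳ-≤ _ _ (2 ^ L) (begin
    ∑ (λ i → m i / 2 ^ L) * 2 ^ L     ≡⟨ *-distribʳ-sum (2 ^ L) (λ i → m i / 2 ^ L) ⟩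
    ∑ (λ i → m i / 2 ^ L * 2 ^ L)     ≤⟨ ∑-mono (λ i → m/n*n≤m (m i) (2 ^ L)) ⟩
    ∑ m                               ≤⟨ <⇒≤ m-small ⟩
    r * (2 * 2 ^ L)                   ≡⟨ *-assoc r 2 (2 ^ L) ⟨
    r * 2 * 2 ^ L                     ∎)

  class-weights≤Z : ∑ (λ i → k + l i) ≤ Z
  class-weights≤Z = begin
    ∑ (λ i → k + l i)                                 ≡⟨ sum-cong-≗ (λ i → +-assoc k L (m i / 2 ^ L)) ⟨
    ∑ (λ i → k + L + m i / 2 ^ L)                     ≡⟨ ∑-distrib-+ (λ _ → k + L) (λ i → m i / 2 ^ L) ⟩
    ∑ {r} (λ _ → k + L) + ∑ (λ i → m i / 2 ^ L)       ≤⟨ +-mono-≤ (≤-reflexive (∑-const r (k + L))) ∑-quotients ⟩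
    -- `1≤L` absorbs the 2 per class from the quotients into 2L, which makes the 3 in `Z`.
    r * (k + L) + r * 2                               ≤⟨ +-monoʳ-≤ (r * (k + L)) (*-monoʳ-≤ r (*-monoʳ-≤ 2 1≤L)) ⟩
    r * (k + L) + r * (2 * L)                         ≡⟨ lemma r k L ⟩
    r * (k + 3 * L)                                   ∎
    where
    lemma : ∀ r k L → r * (k + L) + r * (2 * L) ≡ r * (k + 3 * L)
    lemma = solve-∀

  rk≤Z : r * k ≤ Z
  rk≤Z = *-monoʳ-≤ r (m≤m+n k (3 * L))

  r≤Z : r ≤ Z
  r≤Z = begin
    r       ≡⟨ *-identityʳ r ⟨
    r * 1   ≤⟨ *-monoʳ-≤ r 1≤k ⟩
    r * k   ≤⟨ rk≤Z ⟩
    Z       ∎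

  l≤Z : ∀ i → l i ≤ Z
  l≤Z i = begin
    l i                  ≤⟨ m≤n+m (l i) k ⟩
    k + l i              ≤⟨ term≤∑ (λ i → k + l i) i ⟩
    ∑ (λ i → k + l i)    ≤⟨ class-weights≤Z ⟩
    Z                    ∎

  module _ {n : ℕ} (n-large : 16 * Z ≤ n) where

    -- Reserve and classes weigh at most `Z` each, so W ≤ 2Z; this fixes the constant 16. The factor
    -- 4 is the number of bits gained per unit of weight.
    8W≤n : 4 * (2 * W) ≤ n
    8W≤n = begin
      4 * (2 * W)         ≤⟨ *-monoʳ-≤ 4 (*-monoʳ-≤ 2 (+-monoʳ-≤ Z class-weights≤Z)) ⟩
      4 * (2 * (Z + Z))   ≡⟨ lemma Z ⟩
      16 * Z              ≤⟨ n-large ⟩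
      n                   ∎
      where
      lemma : ∀ z → 4 * (2 * (z + z)) ≡ 16 * z
      lemma = solve-∀

    k≤n : k ≤ n
    k≤n = begin
      k         ≡⟨ *-identityˡ k ⟨
      1 * k     ≤⟨ *-monoˡ-≤ k 1≤r ⟩
      r * k     ≤⟨ rk≤Z ⟩
      Z         ≤⟨ m≤n*m Z 16 ⟩
      16 * Z    ≤⟨ n-large ⟩
      n         ∎

    private
      a : Fin (suc r) → ℕ
      a x = ∑ λ y → w y * penalty x y

    -- The decay estimate with base `a x + w x`, which is 2W: a class of weight `w x` can pay for
    -- `4 * w x` bits.
    2^e*a^n≤[2W]^n : ∀ x e → e ≤ 4 * w x → 2 ^ e * a x ^ n ≤ (2 * W) ^ n
    2^e*a^n≤[2W]^n x e e≤ = begin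
      2 ^ e * a x ^ n            ≤⟨ *-monoˡ-≤ (a x ^ n) (^-monoʳ-≤ 2 e≤) ⟩
      2 ^ (4 * w x) * a x ^ n    ≤⟨ 2^[c*w]*y^n≤[y+w]^n 4 (w x) (a x) n
                                      (≤-trans (≤-reflexive (cong (4 *_) (∑-*-penalty w x))) 8W≤n) ⟩
      (a x + w x) ^ n            ≡⟨ cong (_^ n) (∑-*-penalty w x) ⟩
      (2 * W) ^ n                ∎

    -- Of the bits paid for, `l i` cover the `m i` vertices, `k` the factor `2 ^ k`, and one the
    -- leading 2, which confines this cost to half of the budget of its class.
    own-cost : ∀ i → 2 * (m i * (2 ^ k * a (suc i) ^ n)) ≤ (2 * W) ^ n
    own-cost i = begin
      2 * (m i * (2 ^ k * A))          ≤⟨ *-monoʳ-≤ 2 (*-monoˡ-≤ _ (<⇒≤ (m<2^[L+m/2^L] (m i) L))) ⟩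
      2 * (2 ^ l i * (2 ^ k * A))      ≡⟨ lemma (2 ^ l i) (2 ^ k) A ⟩
      2 * (2 ^ k * 2 ^ l i) * A        ≡⟨ cong (λ x → 2 * x * A) (^-distribˡ-+-* 2 k (l i)) ⟨
      2 ^ suc (k + l i) * A            ≤⟨ 2^e*a^n≤[2W]^n (suc i) (suc (k + l i)) (begin
        suc (k + l i)                    ≤⟨ +-monoˡ-≤ (k + l i) (≤-trans 1≤k (m≤m+n k (l i))) ⟩
        k + l i + (k + l i)              ≤⟨ +-monoʳ-≤ (k + l i) (m≤m+n (k + l i) _) ⟩
        4 * (k + l i)                    ∎) ⟩
      (2 * W) ^ n                      ∎
      where
      A = a (suc i) ^ n
      lemma : ∀ x y z → 2 * (x * (y * z)) ≡ 2 * (y * x) * z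
      lemma = solve-∀

    reserve-cost : ∀ i → 2 * (m i * (suc r * 2 ^ (r * k) * a zero ^ n)) ≤ (2 * W) ^ n
    reserve-cost i = begin
      2 * (m i * (suc r * 2 ^ (r * k) * A))
        ≤⟨ *-monoʳ-≤ 2 (*-mono-≤ (<⇒≤ (m<2^[L+m/2^L] (m i) L)) (*-monoˡ-≤ A (*-monoˡ-≤ (2 ^ (r * k)) (n<2^n r)))) ⟩
      2 * (2 ^ l i * (2 ^ r * 2 ^ (r * k) * A))
        ≡⟨ lemma (2 ^ l i) (2 ^ r) (2 ^ (r * k)) A ⟩
      2 * (2 ^ l i * (2 ^ r * 2 ^ (r * k))) * A
        ≡⟨ cong (λ x → 2 * (2 ^ l i * x) * A) (^-distribˡ-+-* 2 r (r * k)) ⟨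
      2 * (2 ^ l i * 2 ^ (r + r * k)) * A
        ≡⟨ cong (λ x → 2 * x * A) (^-distribˡ-+-* 2 (l i) (r + r * k)) ⟨
      2 ^ suc (l i + (r + r * k)) * A
        -- The reserve affords 4Z bits, one `Z` for each of 1, `l i`, `r` and `r * k`.
        ≤⟨ 2^e*a^n≤[2W]^n zero (suc (l i + (r + r * k)))
             (+-mono-≤ (≤-trans 1≤r r≤Z) (+-mono-≤ (l≤Z i) (+-mono-≤ r≤Z (≤-trans rk≤Z (m≤m+n Z 0))))) ⟩
      (2 * W) ^ n ∎
      where
      A = a zero ^ n
      lemma : ∀ x y z t → 2 * (x * (y * z * t)) ≡ 2 * (x * (y * z)) * t
      lemma = solve-∀

    total-cost : ∑[ vertices m ] (λ v → 2 ^ k * a (suc (proj₁ v)) ^ n + suc r * 2 ^ (r * k) * a zero ^ n)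
                 ≤ r * (2 * W) ^ n
    total-cost = begin
      ∑[ vertices m ] (λ v → own (proj₁ v) + reserve)   ≡⟨ ∑-vertices m (λ i → own i + reserve) ⟩
      ∑ (λ i → m i * (own i + reserve))                 ≤⟨ ∑-mono class-cost ⟩
      ∑ {r} (λ _ → (2 * W) ^ n)                         ≡⟨ ∑-const r _ ⟩
      r * (2 * W) ^ n                                   ∎
      where
      own : Fin r → ℕ
      own i = 2 ^ k * a (suc i) ^ n
      reserve = suc r * 2 ^ (r * k) * a zero ^ n
      lemma : ∀ x y z → 2 * (x * (y + z)) ≡ 2 * (x * y) + 2 * (x * z)
      lemma = solve-∀
      class-cost : ∀ i → m i * (own i + reserve) ≤ (2 * W) ^ n
      class-cost i = *-cancelˡ-≤ 2 (begin
        2 * (m i * (own i + reserve))                  ≡⟨ lemma (m i) (own i) reserve ⟩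
        2 * (m i * own i) + 2 * (m i * reserve)        ≤⟨ +-mono-≤ (own-cost i) (≤-trans (reserve-cost i) (m≤m+n _ 0)) ⟩
        2 * (2 * W) ^ n                                ∎)

    choosable : Choosable (KVertex r m) (KAdj r m) n k
    choosable S S-inj = C , C-inj , λ u v u~v i j eq →
      apart u v u~v i j (fromℕ<-cong _ _ eq (bound u _) (bound v _))
      where
      -- The sum of all entries of all lists bounds every colour, so the colours fit into a finite
      -- set.
      B = suc (∑[ vertices m ] (λ v → ∑ (S v)))
      bound : ∀ v j → S v j < B
      bound v j = s≤s (≤-trans (term≤∑ (S v) j) (term≤∑[] (λ u → ∑ (S u)) (∈-vertices m v)))
      S′ : KVertex r m → Fin n → Fin B
      S′ v j = fromℕ< (bound v j)
      W≢0 : NonZero W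
      W≢0 = >-nonZero (≤-trans (≤-trans 1≤r r≤Z) (m≤m+n Z _))
      result = classChoice (_≟V_ m) (vertices m) (∈-vertices m) proj₁ S′
                 (λ v eq → S-inj v (fromℕ<-injective _ _ (bound v _) (bound v _) eq))
                 k k≤n w {{W≢0}} total-cost
      C = proj₁ result
      C-inj = proj₁ (proj₂ result)
      apart = proj₂ (proj₂ result)

theorem3p1 : (r : ℕ) → 1 ≤ r → (m : Fin r → ℕ) → (∀ i → 2 ≤ m i) →
    (k : ℕ) → 1 ≤ k →
    ∃[ t ] (BoundOK r k (sum (tabulate m)) t ×
    Choosable (KVertex r m) (KAdj r m) (948 * r * k + t) k)
theorem3p1 r 1≤r m 2≤m k 1≤k
  with dyadic-bracket r (sum (tabulate m)) 1≤r (begin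
         r * 2               ≡⟨ ∑-const r 2 ⟨
         ∑ {r} (λ _ → 2)     ≤⟨ ∑-mono 2≤m ⟩
         ∑ m                 ≡⟨ sum-tabulate m ⟨
         sum (tabulate m)    ∎)
  where open ≤-Reasoning
... | L , 1≤L , r2^L≤M , M<r2^[1+L] =
  474 * r * L , boundOK-dyadic r k (sum (tabulate m)) L r2^L≤M ,
  choosable 1≤r m 1≤k 1≤L (≤-trans (≤-reflexive (cong suc (sym (sum-tabulate m)))) M<r2^[1+L]) (begin
    -- The slack is 932 = 948 - 16 in `r * k` and 426 = 474 - 48 in `r * L`.
    16 * (r * (k + 3 * L))                                   ≤⟨ m≤m+n _ (932 * (r * k) + 426 * (r * L)) ⟩
    16 * (r * (k + 3 * L)) + (932 * (r * k) + 426 * (r * L)) ≡⟨ lemma r k L ⟩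
    948 * r * k + 474 * r * L                                ∎)
  where
  open ≤-Reasoning
  lemma : ∀ r k L → 16 * (r * (k + 3 * L)) + (932 * (r * k) + 426 * (r * L)) ≡ 948 * r * k + 474 * r * L
  lemma = solve-∀
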